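{- Let $F,G$ be infinitary formulas over $\sigma$, and let $\mathcal{A}_1,\mathcal{A}_2\subseteq\sigma$ be disjoint sets of atoms such that the partition $\{\mathcal{A}_1,\mathcal{A}_2\}$ of $\mathcal{A}_1\cup\mathcal{A}_2$ is infinitely separable on the positive dependency graph $\mathrm{DG}_{\mathcal{A}_1\cup\mathcal{A}_2}[F\land G]$. If $\mathcal{A}_2$ is disjoint from $\mathrm{P}(F)$ and $\mathcal{A}_1$ is disjoint from $\mathrm{P}(G)$, then for any interpretation $I$ of $\sigma$, $I$ is an $(\mathcal{A}_1\cup\mathcal{A}_2)$-stable model of $F\land G$ if and only if $I$ is both an $\mathcal{A}_1$-stable model of $F$ and an $\mathcal{A}_2$-stable model of $G$.
   Context: Let $\sigma$ be a propositional signature (a set of atoms). Infinitary formulas over $\sigma$ of rank $r$ ($r$ a nonnegative integer) are defined recursively: every atom is a formula of rank $0$; if $\mathcal{H}$ is a set of formulas and $r$ is the smallest nonnegative integer greater than the ranks of all elements of $\mathcal{H}$, then $\mathcal{H}^\land$ and $\mathcal{H}^\lor$ are formulas of rank $r$; if $F,G$ are formulas and $r$ is the smallest nonnegative integer greater than the ranks of $F$ and $G$, then $F\rightarrow G$ is a formula of rank $r$. Abbreviations: $F\land G=\{F,G\}^\land$, $F\lor G=\{F,G\}^\lor$, $\top=\emptyset^\land$, $\bot=\emptyset^\lor$, $\neg F=F\rightarrow\bot$. An interpretation is a subset $I\subseteq\sigma$. Satisfaction: $I\models p$ iff $p\in I$; $I\models\mathcal{H}^\land$ iff $I\models F$ for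 all $F\in\mathcal{H}$; $I\models\mathcal{H}^\lor$ iff $I\models F$ for some $F\in\mathcal{H}$; $I\models F\rightarrow G$ iff $I\not\models F$ or $I\models G$. The reduct $F^I$: $p^I$ is $p$ if $p\in I$ and $\bot$ otherwise; $(\mathcal{H}^\land)^I=\{G^I: G\in\mathcal{H}\}^\land$; $(\mathcal{H}^\lor)^I=\{G^I: G\in\mathcal{H}\}^\lor$; $(G\rightarrow H)^I$ is $G^I\rightarrow H^I$ if $I\models G\rightarrow H$, and $\bot$ otherwise. For $\mathcal{A}\subseteq\sigma$ and $I,J\subseteq\sigma$, write $I\leq_{\mathcal{A}}J$ if $I\subseteq J$ and $J\setminus I\subseteq\mathcal{A}$. $I$ is an $\mathcal{A}$-stable model of $F$ if $I$ is a minimal model of $F^I$ with respect to $\leq_{\mathcal{A}}$ (i.e. $I\models F^I$ and no $J\neq I$ with $J\leq_{\mathcal{A}}I$ satisfies $F^I$). Strictly positive atoms: $\mathrm{P}(p)=\{p\}$; $\mathrm{P}(\mathcal{H}^\land)=\mathrm{P}(\mathcal{H}^\lor)=\bigcup_{H\in\mathcal{H}}\mathrm{P}(H)$; $\mathrm{P}(G\rightarrow H)=\mathrm{P}(H)$. Positive nonnegated atoms $\mathrm{Pnn}$ and negative nonnegated atoms $\mathrm{Nnn}$: $\mathrm{Pnn}(p)=\{p\}$, $\mathrm{Nnn}(p)=\emptyset$; for $\mathcal{H}^\land$ and $\mathcal{H}^\lor$ take the union over $H\in\mathcal{H}$ of $\mathrm{Pnn}(H)$, respectively $\mathrm{Nnn}(H)$;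 if $H$ is $\bot$ then $\mathrm{Pnn}(G\rightarrow H)=\mathrm{Nnn}(G\rightarrow H)=\emptyset$; otherwise $\mathrm{Pnn}(G\rightarrow H)=\mathrm{Nnn}(G)\cup\mathrm{Pnn}(H)$ and $\mathrm{Nnn}(G\rightarrow H)=\mathrm{Pnn}(G)\cup\mathrm{Nnn}(H)$. Rules: an atom has no rules; the rules of $G\rightarrow H$ are $G\rightarrow H$ and all rules of $H$; the rules of $\mathcal{H}^\land$ and $\mathcal{H}^\lor$ are the rules of all formulas in $\mathcal{H}$. The (positive) dependency graph $\mathrm{DG}_{\mathcal{A}}[F]$ is the directed graph with vertex set $\mathcal{A}$ that has an edge from $p$ to $q$ if for some rule $G\rightarrow H$ of $F$, $p\in\mathrm{P}(H)$ and $q\in\mathrm{Pnn}(G)$. A partition of a set is a set of disjoint, possibly empty, subsets that cover it. An infinite walk of a directed graph is an infinite sequence $(v_1,v_2,\dots)$ of vertices such that each pair $v_i,v_{i+1}$ is an edge from $v_i$ to $v_{i+1}$. A partition $\{\mathcal{P}_1,\mathcal{P}_2\}$ of the vertices of a directed graph is infinitely separable on it if for every infinite walk $(v_1,v_2,\dots)$, either $\{i: v_i\in\mathcal{P}_1\}$ or $\{i: v_i\in\mathcal{P}_2\}$ is finite. -}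

module Defs where

open import Axiom.ExcludedMiddle using (ExcludedMiddle)
open import Data.Bool.Base using (Bool; if_then_else_)
open import Data.Empty.Polymorphic using (⊥)
open import Data.Nat.Base using (ℕ; suc; _≤_; _<_)
open import Data.Nat.InfinitelyOften using () renaming (Fin to Finite)
open import Data.Product.Base using (Σ; ∃-syntax; _×_; _,_)
open import Data.Sum.Base using (_⊎_)
open import Level using (Lift; lower) renaming (suc to lsuc)
open import Relation.Binary.Core using (Rel)
open import Relation.Nullary using (¬_; yes; no)
open import Relation.Unary using (Pred; _∈_; _⊆_; _≐_; _∪_; _∖_; ｛_｝; ⋃)

infixr 5 _⇒_

-- A set 𝓗 of formulas is given as a family H : I → PreFormula σ, the set being
-- the range of H.  Repetitions in the family do not affect any notion below.
-- Pre-formulas carry no bound on ranks; the formulas are the pre-formulas that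
-- have a (finite) rank, see IsFormula.

data PreFormula {ℓ} (σ : Set ℓ) : Set (lsuc ℓ) where
  atom : σ → PreFormula σ
  ⋀    : (I : Set ℓ) → (I → PreFormula σ) → PreFormula σ
  ⋁    : (I : Set ℓ) → (I → PreFormula σ) → PreFormula σ
  _⇒_  : PreFormula σ → PreFormula σ → PreFormula σ

Least : ∀ {a} → Pred ℕ a → Pred ℕ a
Least Q r = Q r × (∀ s → Q s → r ≤ s)

data HasRank {ℓ} {σ : Set ℓ} : PreFormula σ → ℕ → Set (lsuc ℓ) where
  atom : ∀ p → HasRank (atom p) 0
  ⋀    : ∀ {I H r} (ρ : I → ℕ) → (∀ i → HasRank (H i) (ρ i)) →
         Least (λ s → ∀ i → ρ i < s) r → HasRank (⋀ I H) r
  ⋁    : ∀ {I H r} (ρ : I → ℕ) → (∀ i → HasRank (H i) (ρ i)) →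
         Least (λ s → ∀ i → ρ i < s) r → HasRank (⋁ I H) r
  _⇒_  : ∀ {F G m n} → HasRank F m → HasRank G n →
         ∀ {r} → Least (λ s → m < s × n < s) r → HasRank (F ⇒ G) r

module _ {ℓ} {σ : Set ℓ} where

  infixr 6 _∧_
  infix  4 _⊨_ _≤[_]_

  IsFormula : PreFormula σ → Set (lsuc ℓ)
  IsFormula F = ∃[ r ] HasRank F r

  _∧_ : PreFormula σ → PreFormula σ → PreFormula σ
  F ∧ G = ⋀ (Lift ℓ Bool) λ b → if lower b then F else G

  bot : PreFormula σ
  bot = ⋁ ⊥ λ ()

  -- F is the formula ∅^∨.  Any family over an empty index type represents ∅.
  IsBot : PreFormula σ → Set ℓ
  IsBot (⋁ I _)  = ¬ I
  IsBot (atom _) = ⊥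
  IsBot (⋀ _ _)  = ⊥
  IsBot (_ ⇒ _)  = ⊥

  _⊨_ : Pred σ ℓ → PreFormula σ → Set ℓ
  I ⊨ atom p = p ∈ I
  I ⊨ ⋀ K H  = ∀ k → I ⊨ H k
  I ⊨ ⋁ K H  = ∃[ k ] I ⊨ H k
  I ⊨ F ⇒ G  = ¬ (I ⊨ F) ⊎ I ⊨ G

  -- The definition of the reduct by cases is classical: excluded middle is
  -- needed to decide p ∈ I and I ⊨ G ⇒ H.
  reduct : ExcludedMiddle ℓ → PreFormula σ → Pred σ ℓ → PreFormula σ
  reduct em (atom p) I with em {p ∈ I}
  ... | yes _ = atom p
  ... | no  _ = bot
  reduct em (⋀ K H) I = ⋀ K λ k → reduct em (H k) I
  reduct em (⋁ K H) I = ⋁ K λ k → reduct em (H k) I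
  reduct em (G ⇒ H) I with em {I ⊨ G ⇒ H}
  ... | yes _ = reduct em G I ⇒ reduct em H I
  ... | no  _ = bot

  _≤[_]_ : Pred σ ℓ → Pred σ ℓ → Pred σ ℓ → Set ℓ
  I ≤[ 𝒜 ] J = I ⊆ J × J ∖ I ⊆ 𝒜

  -- Equality of interpretations is extensional equality of predicates, _≐_.
  IsStableModel : ExcludedMiddle ℓ → Pred σ ℓ → PreFormula σ → Pred σ ℓ → Set (lsuc ℓ)
  IsStableModel em 𝒜 F I =
    I ⊨ reduct em F I ×
    ¬ (∃[ J ] ¬ (J ≐ I) × J ≤[ 𝒜 ] I × J ⊨ reduct em F I)

  P : PreFormula σ → Pred σ ℓ
  P (atom p) = ｛ p ｝
  P (⋀ I H)  = ⋃[ i ∶ I ] P (H i)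
  P (⋁ I H)  = ⋃[ i ∶ I ] P (H i)
  P (G ⇒ H)  = P H

  mutual
    Pnn : PreFormula σ → Pred σ ℓ
    Pnn (atom p) = ｛ p ｝
    Pnn (⋀ I H)  = ⋃[ i ∶ I ] Pnn (H i)
    Pnn (⋁ I H)  = ⋃[ i ∶ I ] Pnn (H i)
    Pnn (G ⇒ H)  = λ p → ¬ IsBot H × p ∈ Nnn G ∪ Pnn H

    Nnn : PreFormula σ → Pred σ ℓ
    Nnn (atom p) = λ _ → ⊥
    Nnn (⋀ I H)  = ⋃[ i ∶ I ] Nnn (H i)
    Nnn (⋁ I H)  = ⋃[ i ∶ I ] Nnn (H i)
    Nnn (G ⇒ H)  = λ p → ¬ IsBot H × p ∈ Pnn G ∪ Nnn H

  -- HasRule F G H: the implication G ⇒ H is a rule of F.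
  data HasRule : PreFormula σ → PreFormula σ → PreFormula σ → Set (lsuc ℓ) where
    self : ∀ {G H} → HasRule (G ⇒ H) G H
    head : ∀ {G H G′ H′} → HasRule H G′ H′ → HasRule (G ⇒ H) G′ H′
    conj : ∀ {I K G′ H′} (i : I) → HasRule (K i) G′ H′ → HasRule (⋀ I K) G′ H′
    disj : ∀ {I K G′ H′} (i : I) → HasRule (K i) G′ H′ → HasRule (⋁ I K) G′ H′

  -- The edge relation of the dependency graph, on the vertex set 𝒜.
  DG : (𝒜 : Pred σ ℓ) → PreFormula σ → Rel (Σ σ 𝒜) (lsuc ℓ)
  DG 𝒜 F (p , _) (q , _) = ∃[ G ] ∃[ H ] HasRule F G H × p ∈ P H × q ∈ Pnn G

module _ {a e} {V : Set a} (E : Rel V e) where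

  IsInfiniteWalk : (ℕ → V) → Set e
  IsInfiniteWalk v = ∀ i → E (v i) (v (suc i))

  InfinitelySeparable : ∀ {ℓ} → Pred V ℓ → Pred V ℓ → Set _
  InfinitelySeparable P₁ P₂ = ∀ v → IsInfiniteWalk v →
    Finite (λ i → v i ∈ P₁) ⊎ Finite (λ i → v i ∈ P₂)

{-# OPTIONS --safe #-}

-- If I ⊨ F and I ∖ J avoids the strictly positive atoms of F, then J ⊨ F^I; this
-- gives the left-to-right direction.  Conversely, let J ≤ I with J ≠ I satisfy the
-- reduct of F ∧ G, and restrict the dependency graph to X = I ∖ J.  If every vertex
-- of X could reach in X a vertex of the other part, joining the paths would give a
-- walk that visits both parts infinitely often.  So some vertex of X reaches only
-- vertices of its own part, say 𝒜₁.  The set K of these vertices has no edge to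
-- X ∖ K, whence I ∖ K satisfies F^I, and I is not 𝒜₁-stable for F.
module Submission where

open import Defs
open import Axiom.ExcludedMiddle using (ExcludedMiddle)
open import Data.Bool.Base using (Bool; true; false)
open import Data.Nat.Base using (ℕ; zero; suc; _≤_)
open import Data.Nat.Properties using (≤-refl; ≤-trans; n≤1+n)
open import Data.Product.Base using (Σ; ∃-syntax; _×_; _,_; proj₁; proj₂)
open import Data.Sum.Base using (_⊎_; inj₁; inj₂; [_,_]′)
open import Function.Base using (_∘_; _on_)
open import Function.Bundles using (_⇔_; mk⇔)
open import Level using (Lift; lift; _⊔_)
open import Relation.Binary.Construct.Closure.ReflexiveTransitive using (Star; ε; _◅_; _◅◅_)
open import Relation.Binary.Core using (Rel)
open import Relation.Binary.PropositionalEquality using (_≡_; refl; sym; cong; subst)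
open import Relation.Nullary using (¬_; yes; no; contradiction)
open import Relation.Nullary.Decidable using (True; toWitness; fromWitness; decidable-stable)
open import Relation.Unary using (Pred; _∈_; _∉_; _⊆_; _∪_; _∖_; _⊥_; _≐_)

-- Satisfaction of reducts

⊨bot-elim : ∀ {ℓ a} {σ : Set ℓ} {J : Pred σ ℓ} {A : Set a} → J ⊨ bot → A
⊨bot-elim (() , _)

IsBot⇒⊭ : ∀ {ℓ} {σ : Set ℓ} {I : Pred σ ℓ} (H : PreFormula σ) → IsBot H → ¬ (I ⊨ H)
IsBot⇒⊭ (⋁ _ _) empty (k , _) = empty k

module _ {ℓ} {σ : Set ℓ} (em : ExcludedMiddle ℓ) (I : Pred σ ℓ) where

  infix 4 _⊩_

  _⊩_ : Pred σ ℓ → PreFormula σ → Set ℓ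
  J ⊩ F = J ⊨ reduct em F I

  module _ {J : Pred σ ℓ} where

    ⊩-atom⁻ : ∀ {p} → J ⊩ atom p → p ∈ J
    ⊩-atom⁻ {p} s with em {p ∈ I}
    ... | yes _ = s
    ... | no  _ = ⊨bot-elim {J = J} s

    ⊩-atom⁺ : ∀ {p} → p ∈ I → p ∈ J → J ⊩ atom p
    ⊩-atom⁺ {p} p∈I p∈J with em {p ∈ I}
    ... | yes _  = p∈J
    ... | no p∉I = contradiction p∈I p∉I

    ⊩-⇒⁻ : ∀ G H → J ⊩ (G ⇒ H) → I ⊨ G ⇒ H × (J ⊩ G → J ⊩ H)
    ⊩-⇒⁻ G H s with em {I ⊨ G ⇒ H}
    ... | yes t = t , λ g → [ contradiction g , (λ h → h) ]′ s
    ... | no  _ = ⊨bot-elim {J = J} s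

    ⊩-⇒⁺ : ∀ G H → I ⊨ G ⇒ H → (J ⊩ G → J ⊩ H) → J ⊩ (G ⇒ H)
    ⊩-⇒⁺ G H t f with em {I ⊨ G ⇒ H}
    ... | no ¬t = contradiction t ¬t
    ... | yes _ with em {J ⊩ G}
    ...   | yes g = inj₂ (f g)
    ...   | no ¬g = inj₁ ¬g

  ⊩⇒⊨ : ∀ {J} → J ⊆ I → ∀ F → J ⊩ F → I ⊨ F
  ⊩⇒⊨ J⊆I (atom p) s       = J⊆I (⊩-atom⁻ s)
  ⊩⇒⊨ J⊆I (⋀ _ H)  s       = λ k → ⊩⇒⊨ J⊆I (H k) (s k)
  ⊩⇒⊨ J⊆I (⋁ _ H)  (k , s) = k , ⊩⇒⊨ J⊆I (H k) s
  ⊩⇒⊨ J⊆I (G ⇒ H)  s       = proj₁ (⊩-⇒⁻ G H s)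

  ⊨-mp : ∀ {G H} → I ⊨ G ⇒ H → I ⊨ G → I ⊨ H
  ⊨-mp (inj₁ ¬g) g = contradiction g ¬g
  ⊨-mp (inj₂ h)  _ = h

  -- In an implication only the head needs the induction: `J ⊩ G` already yields `I ⊨ G`, hence
  -- `I ⊨ H`. So the atoms of antecedents are irrelevant.
  ⊨⇒⊩ : ∀ {J} → J ⊆ I → ∀ F → I ∖ J ⊥ P F → I ⊨ F → J ⊩ F
  ⊨⇒⊩ {J} J⊆I (atom p) apart p∈I =
    ⊩-atom⁺ p∈I (decidable-stable em λ p∉J → apart ((p∈I , p∉J) , refl))
  ⊨⇒⊩ J⊆I (⋀ _ H) apart s k = ⊨⇒⊩ J⊆I (H k) (λ (x , y) → apart (x , k , y)) (s k)
  ⊨⇒⊩ J⊆I (⋁ _ H) apart (k , s) = k , ⊨⇒⊩ J⊆I (H k) (λ (x , y) → apart (x , k , y)) s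
  ⊨⇒⊩ J⊆I (G ⇒ H) apart t =
    ⊩-⇒⁺ G H t λ g → ⊨⇒⊩ J⊆I H apart (⊨-mp {G} {H} t (⊩⇒⊨ J⊆I G g))

  module _ {J L : Pred σ ℓ} (J⊆L : J ⊆ L) (L⊆I : L ⊆ I) where

    -- When H is ⊥ the implication G ⇒ H contributes no atoms at all; but then, for
    -- L ⊆ I, truth of its reduct in L depends on I only.
    ⊩-antitone : ∀ F → L ∖ J ⊥ Pnn F → L ⊩ F → J ⊩ F
    ⊩-monotone : ∀ F → L ∖ J ⊥ Nnn F → J ⊩ F → L ⊩ F

    ⊩-antitone (atom p) apart s =
      ⊩-atom⁺ (L⊆I p∈L) (decidable-stable em λ p∉J → apart ((p∈L , p∉J) , refl))
      where p∈L = ⊩-atom⁻ s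
    ⊩-antitone (⋀ _ H) apart s k = ⊩-antitone (H k) (λ (x , y) → apart (x , k , y)) (s k)
    ⊩-antitone (⋁ _ H) apart (k , s) = k , ⊩-antitone (H k) (λ (x , y) → apart (x , k , y)) s
    ⊩-antitone (G ⇒ H) apart s with ⊩-⇒⁻ G H s | em {IsBot H}
    ... | t , f | yes b = ⊩-⇒⁺ G H t λ g →
      contradiction (⊨-mp {G} {H} t (⊩⇒⊨ (L⊆I ∘ J⊆L) G g)) (IsBot⇒⊭ H b)
    ... | t , f | no ¬b = ⊩-⇒⁺ G H t λ g →
      ⊩-antitone H (λ (x , y) → apart (x , ¬b , inj₂ y))
        (f (⊩-monotone G (λ (x , y) → apart (x , ¬b , inj₁ y)) g))

    ⊩-monotone (atom p) apart s = ⊩-atom⁺ (L⊆I p∈L) p∈L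
      where p∈L = J⊆L (⊩-atom⁻ s)
    ⊩-monotone (⋀ _ H) apart s k = ⊩-monotone (H k) (λ (x , y) → apart (x , k , y)) (s k)
    ⊩-monotone (⋁ _ H) apart (k , s) = k , ⊩-monotone (H k) (λ (x , y) → apart (x , k , y)) s
    ⊩-monotone (G ⇒ H) apart s with ⊩-⇒⁻ G H s | em {IsBot H}
    ... | t , f | yes b = ⊩-⇒⁺ G H t λ g →
      contradiction (⊨-mp {G} {H} t (⊩⇒⊨ L⊆I G g)) (IsBot⇒⊭ H b)
    ... | t , f | no ¬b = ⊩-⇒⁺ G H t λ g →
      ⊩-monotone H (λ (x , y) → apart (x , ¬b , inj₂ y))
        (f (⊩-antitone G (λ (x , y) → apart (x , ¬b , inj₁ y)) g))

  -- No edge of the dependency graph leads from `K` to the rest of `X`. Phrased through rules, the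
  -- condition passes to subformulas by composing with `conj`, `disj` or `head`.
  ClosedIn : Pred σ ℓ → PreFormula σ → Pred σ ℓ → Set _
  ClosedIn X F K = ∀ {G H p q} → HasRule F G H →
    p ∈ P H → p ∈ K → q ∈ Pnn G → q ∈ X → q ∈ K

  ⊩-∖-closed : ∀ {J K} → J ⊆ I → K ⊆ I ∖ J →
    ∀ F → ClosedIn (I ∖ J) F K → J ⊩ F → I ∖ K ⊩ F
  ⊩-∖-closed J⊆I K⊆X (atom p) cl s =
    ⊩-atom⁺ (J⊆I p∈J) (J⊆I p∈J , λ p∈K → proj₂ (K⊆X p∈K) p∈J)
    where p∈J = ⊩-atom⁻ s
  ⊩-∖-closed J⊆I K⊆X (⋀ _ H) cl s k = ⊩-∖-closed J⊆I K⊆X (H k) (cl ∘ conj k) (s k)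
  ⊩-∖-closed J⊆I K⊆X (⋁ _ H) cl (k , s) = k , ⊩-∖-closed J⊆I K⊆X (H k) (cl ∘ disj k) s
  ⊩-∖-closed {J} {K} J⊆I K⊆X (G ⇒ H) cl s
    with ⊩-⇒⁻ G H s | em {∃[ p ] p ∈ P H × p ∈ K}
  -- If `K` meets `P H`, closedness puts every atom of `Pnn G` in `I ∖ J` into `K`. So `G` passes
  -- down from `I ∖ K` to `J`, and `H` comes back up by induction.
  ... | t , f | yes (p , p∈PH , p∈K) = ⊩-⇒⁺ G H t λ g →
    ⊩-∖-closed J⊆I K⊆X H (cl ∘ head)
      (f (⊩-antitone J⊆I∖K proj₁ G
        (λ (((q∈I , q∉K) , q∉J) , q∈G) → q∉K (cl self p∈PH p∈K q∈G (q∈I , q∉J))) g))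
    where
    J⊆I∖K : J ⊆ I ∖ K
    J⊆I∖K p∈J = J⊆I p∈J , λ p∈K → proj₂ (K⊆X p∈K) p∈J
  ... | t , f | no none = ⊩-⇒⁺ G H t λ g →
    ⊨⇒⊩ proj₁ H
      (λ ((p∈I , p∉I∖K) , p∈PH) → p∉I∖K (p∈I , λ p∈K → none (_ , p∈PH , p∈K)))
      (⊨-mp {G} {H} t (⊩⇒⊨ proj₁ G g))

  stable⇒no-closed : ∀ {𝒜 F J K} → IsStableModel em 𝒜 F I → J ⊆ I → J ⊩ F →
    K ⊆ I ∖ J → K ⊆ 𝒜 → ClosedIn (I ∖ J) F K → ∀ {p} → p ∉ K
  stable⇒no-closed {F = F} {K = K} (_ , minimal) J⊆I s K⊆X K⊆𝒜 cl p∈K = minimal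
    ( I ∖ K
    , (λ (_ , I⊆I∖K) → proj₂ (I⊆I∖K (proj₁ (K⊆X p∈K))) p∈K)
    , (proj₁ , λ (p∈I , p∉I∖K) → K⊆𝒜 (decidable-stable em λ p∉K → p∉I∖K (p∈I , p∉K)))
    , ⊩-∖-closed J⊆I K⊆X F cl s )

  -- Meant for a conjunction `C` with conjunct `F`: a counterexample to minimality for `F` and `ℬ`
  -- is also one for `C` and `𝒜`.
  stable-weaken : ∀ {𝒜 ℬ F C} → ℬ ⊆ 𝒜 → (I ⊩ C → I ⊩ F) →
    (∀ {J} → J ≤[ ℬ ] I → J ⊩ F → J ⊩ C) →
    IsStableModel em 𝒜 C I → IsStableModel em ℬ F I
  stable-weaken ℬ⊆𝒜 C⇒F F⇒C (s , minimal) = C⇒F s , λ (J , J≢I , J≤I , t) →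
    minimal (J , J≢I , (proj₁ J≤I , ℬ⊆𝒜 ∘ proj₂ J≤I) , F⇒C J≤I t)

-- Infinite walks and trapped vertices

module _ {a e p} (em : ∀ {a} → ExcludedMiddle a)
         {V : Set a} (E : Rel V e) (P₁ P₂ : Pred V p) (cover : ∀ v → v ∈ P₁ ∪ P₂) where

  Opposite : Rel V p
  Opposite v w = (v ∈ P₁ × w ∈ P₂) ⊎ (v ∈ P₂ × w ∈ P₁)

  -- The path must have an edge: P₁ and P₂ may overlap, and then v can be opposite
  -- to itself.
  Escapes : V → Set _
  Escapes v = ∃[ w ] Opposite v w × ∃[ u ] E v u × Star E u w

  Trapped : V → Set _
  Trapped v = (∀ {w} → Star E v w → w ∈ P₁) ⊎ (∀ {w} → Star E v w → w ∈ P₂)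

  module _ (escape : ∀ v → Escapes v) where

    -- A vertex of the walk, together with the rest of the path being followed.
    record State : Set (a ⊔ e) where
      constructor state
      field
        {here next target} : V
        edge : E here next
        path : Star E next target

    open State

    start : V → State
    start v = let _ , _ , _ , e , es = escape v in state e es

    step : State → State
    -- The pending edge ends at the target `u`, so the next escape path begins there.
    step (state {next = u} _ ε) = start u
    step (state _ (e ◅ es))     = state e es

    step-edge : ∀ s → E (here s) (here (step s))
    step-edge (state e ε)       = e
    step-edge (state e (_ ◅ _)) = e

    states : V → ℕ → State
    states v zero    = start v
    states v (suc n) = step (states v n)

    -- The equation lets the recursion follow `es` while the index advances.
    reaches-target : ∀ v i {x u w} (e : E x u) (es : Star E u w) →
      states v i ≡ state e es → ∃[ j ] i ≤ j × states v j ≡ start w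
    reaches-target v i e ε eq = suc i , n≤1+n i , cong step eq
    reaches-target v i e (e′ ◅ es) eq =
      let j , i<j , eq′ = reaches-target v (suc i) e′ es (cong step eq)
      in  j , ≤-trans (n≤1+n i) i<j , eq′

    Visits : V → ℕ → Pred V p → Set _
    Visits v i Q = ∃[ j ] i ≤ j × here (states v j) ∈ Q

    -- After time `i` the walk reaches the end `w` of the current path, then the end `w′` of the
    -- escape path from `w`, which lies opposite to `w`.
    visits-both : ∀ v i → Visits v i P₁ × Visits v i P₂
    visits-both v i = go (proj₁ (proj₂ (escape w)))
      where
      w = target (states v i)
      first = reaches-target v i (edge (states v i)) (path (states v i)) refl
      j = proj₁ first
      i≤j = proj₁ (proj₂ first)
      at-w = proj₂ (proj₂ first)
      second = reaches-target v j (edge (start w)) (path (start w)) at-w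
      w′ = target (start w)

      visits-w : ∀ Q → w ∈ Q → Visits v i Q
      visits-w Q w∈Q = j , i≤j , subst (Q ∘ here) (sym at-w) w∈Q

      visits-w′ : ∀ Q → w′ ∈ Q → Visits v i Q
      visits-w′ Q w′∈Q =
        let k , j≤k , at-w′ = second
        in  k , ≤-trans i≤j j≤k , subst (Q ∘ here) (sym at-w′) w′∈Q

      go : Opposite w w′ → Visits v i P₁ × Visits v i P₂
      go (inj₁ (w∈P₁ , w′∈P₂)) = visits-w P₁ w∈P₁ , visits-w′ P₂ w′∈P₂
      go (inj₂ (w∈P₂ , w′∈P₁)) = visits-w′ P₁ w′∈P₁ , visits-w P₂ w∈P₂

    escape⇒¬separable : V → ¬ InfinitelySeparable E P₁ P₂
    escape⇒¬separable v sep with sep (here ∘ states v) (step-edge ∘ states v)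
    ... | inj₁ (i , never) = let j , i≤j , v∈P₁ = proj₁ (visits-both v i) in never j i≤j v∈P₁
    ... | inj₂ (i , never) = let j , i≤j , v∈P₂ = proj₂ (visits-both v i) in never j i≤j v∈P₂

  -- A vertex that does not escape is trapped, by `cover`; if all escaped, the walk from `v₀` would
  -- violate separability.
  trapped-vertex : InfinitelySeparable E P₁ P₂ → V → ∃[ v ] Trapped v
  trapped-vertex sep v₀ = decidable-stable em λ none →
    escape⇒¬separable (λ v → decidable-stable em λ ¬esc → none (v , trapped v ¬esc)) v₀ sep
    where
    trapped : ∀ v → ¬ Escapes v → Trapped v
    trapped v ¬esc with cover v
    ... | inj₁ v∈P₁ = inj₁ λ where
      ε        → v∈P₁
      (e ◅ es) → [ (λ w∈P₁ → w∈P₁)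
                 , (λ w∈P₂ → contradiction (_ , inj₁ (v∈P₁ , w∈P₂) , _ , e , es) ¬esc)
                 ]′ (cover _)
    ... | inj₂ v∈P₂ = inj₂ λ where
      ε        → v∈P₂
      (e ◅ es) → [ (λ w∈P₁ → contradiction (_ , inj₂ (v∈P₂ , w∈P₁) , _ , e , es) ¬esc)
                 , (λ w∈P₂ → w∈P₂)
                 ]′ (cover _)

-- Splitting a conjunction

mainTheorem2 : (em : ∀ {a} → ExcludedMiddle a) →
    ∀ {ℓ} {σ : Set ℓ} (F G : PreFormula σ) → IsFormula F → IsFormula G →
    (𝒜₁ 𝒜₂ : Pred σ ℓ) → 𝒜₁ ⊥ 𝒜₂ →
    InfinitelySeparable (DG (𝒜₁ ∪ 𝒜₂) (F ∧ G)) (𝒜₁ ∘ proj₁) (𝒜₂ ∘ proj₁) →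
    𝒜₂ ⊥ P F → 𝒜₁ ⊥ P G →
    (I : Pred σ ℓ) →
    IsStableModel em (𝒜₁ ∪ 𝒜₂) (F ∧ G) I ⇔ (IsStableModel em 𝒜₁ F I × IsStableModel em 𝒜₂ G I)
mainTheorem2 em {ℓ} {σ} F G _ _ 𝒜₁ 𝒜₂ _ sep 𝒜₂⊥PF 𝒜₁⊥PG I = mk⇔ split join
  where
  left right : Lift ℓ Bool
  left  = lift true
  right = lift false

  both : ∀ {J} → J ⊨ reduct em F I → J ⊨ reduct em G I → J ⊨ reduct em (F ∧ G) I
  both f g (lift true)  = f
  both f g (lift false) = g

  split : IsStableModel em (𝒜₁ ∪ 𝒜₂) (F ∧ G) I →
          IsStableModel em 𝒜₁ F I × IsStableModel em 𝒜₂ G I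
  split st =
      stable-weaken em I {F = F} {C = F ∧ G} inj₁ (λ s → s left)
        (λ (J⊆I , X⊆𝒜₁) f → both f
          (⊨⇒⊩ em I J⊆I G (λ (x , y) → 𝒜₁⊥PG (X⊆𝒜₁ x , y)) (I⊨ right))) st
    , stable-weaken em I {F = G} {C = F ∧ G} inj₂ (λ s → s right)
        (λ (J⊆I , X⊆𝒜₂) g → both
          (⊨⇒⊩ em I J⊆I F (λ (x , y) → 𝒜₂⊥PF (X⊆𝒜₂ x , y)) (I⊨ left)) g) st
    where
    I⊨ : I ⊨ F ∧ G
    I⊨ = ⊩⇒⊨ em I (λ p∈I → p∈I) (F ∧ G) (proj₁ st)

  join : IsStableModel em 𝒜₁ F I × IsStableModel em 𝒜₂ G I →
         IsStableModel em (𝒜₁ ∪ 𝒜₂) (F ∧ G) I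
  join (stF , stG) = both (proj₁ stF) (proj₁ stG) , refute
    where
    refute : ¬ (∃[ J ] ¬ (J ≐ I) × J ≤[ 𝒜₁ ∪ 𝒜₂ ] I × J ⊨ reduct em (F ∧ G) I)
    refute (J , J≢I , (J⊆I , X⊆𝒜) , s) = J≢I (J⊆I , I⊆J)
      where
      X : Pred σ ℓ
      X = I ∖ J

      vertex : Σ σ X → Σ σ (𝒜₁ ∪ 𝒜₂)
      vertex (p , p∈X) = p , X⊆𝒜 p∈X

      E : Rel (Σ σ X) _
      E = DG (𝒜₁ ∪ 𝒜₂) (F ∧ G) on vertex

      -- Reachability lives in a higher universe than interpretations; excluded
      -- middle brings it down.
      Reach : Σ σ X → Pred σ ℓ
      Reach v p = Lift ℓ (True (em {P = Σ (p ∈ X) λ p∈X → Star E v (p , p∈X)}))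

      reach⁻ : ∀ {v p} → p ∈ Reach v → Σ (p ∈ X) λ p∈X → Star E v (p , p∈X)
      reach⁻ (lift t) = toWitness t

      reach-closed : ∀ v → ClosedIn em I X (F ∧ G) (Reach v)
      reach-closed v {G = B} {H = H} r p∈H p∈K q∈B q∈X =
        let _ , es = reach⁻ p∈K
        in  lift (fromWitness (q∈X , es ◅◅ ((B , H , r , p∈H , q∈B) ◅ ε)))

      here∈reach : ∀ v → proj₁ v ∈ Reach v
      here∈reach (_ , p∈X) = lift (fromWitness (p∈X , ε))

      -- `Reach v` is closed, contains `v` and lies in one part, which the stability of the matching
      -- conjunct forbids.
      ¬trapped : ∀ v → ¬ Trapped em E (𝒜₁ ∘ proj₁) (𝒜₂ ∘ proj₁) (X⊆𝒜 ∘ proj₂) v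
      ¬trapped v (inj₁ ⊆𝒜₁) =
        stable⇒no-closed em I stF J⊆I (s left) (proj₁ ∘ reach⁻) (⊆𝒜₁ ∘ proj₂ ∘ reach⁻)
          (reach-closed v ∘ conj left) (here∈reach v)
      ¬trapped v (inj₂ ⊆𝒜₂) =
        stable⇒no-closed em I stG J⊆I (s right) (proj₁ ∘ reach⁻) (⊆𝒜₂ ∘ proj₂ ∘ reach⁻)
          (reach-closed v ∘ conj right) (here∈reach v)

      I⊆J : I ⊆ J
      I⊆J {p} p∈I = decidable-stable em λ p∉J →
        let v , trapped = trapped-vertex em E (𝒜₁ ∘ proj₁) (𝒜₂ ∘ proj₁) (X⊆𝒜 ∘ proj₂)
                            -- Walks inside `X` are walks of the full graph, so the restriction to
                            -- `X` inherits separability.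
                            (λ w → sep (vertex ∘ w)) (p , p∈I , p∉J)
        in  ¬trapped v trapped
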